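{- The graph $\Gamma_{l-i}(M_n(F_q))$ is connected, its diameter is $diam(\Gamma_{l-i}(M_n(F_q))) = 2$, and its radius is $r(\Gamma_{l-i}(M_n(F_q))) = 1$.
   Context: $q$ is a prime power, $n$ is a positive integer, $F_q$ is the finite field with $q$ elements and $M_n(F_q)$ is the ring of all $n\times n$ matrices over $F_q$. For $X \in M_n(F_q)$, $[X] = \{AX : A \in M_n(F_q)\}$ is the left ideal generated by $X$. The undirected left-ideal relation graph $\Gamma_{l-i}(M_n(F_q))$ is the simple graph with vertex set $M_n(F_q)$ in which two distinct vertices $X, Y$ are adjacent if and only if $[X] \subset [Y]$ or $[Y] \subset [X]$, where $\subset$ denotes proper containment. The distance between two vertices is the number of edges in a shortest path connecting them. The eccentricity of a vertex is its maximum distance to any vertex of the graph; the diameter and radius are respectively the maximum and minimum eccentricity over all vertices.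
   Formalization: The claim that the diameter is 2 excludes the single case n = 1, q = 2, where the graph is one edge on the vertices 0 and 1 and has diameter 1; connectedness and radius 1 are stated for all prime powers q and all n ≥ 1. -}

module Defs where

open import Level using (Level; _⊔_; suc)
open import Algebra.Bundles using (CommutativeRing)
open import Algebra.Definitions using (Invertible)
import Algebra.Properties.Semiring.Sum as Sum
open import Data.Fin.Base using (Fin)
open import Data.List.Base using (List; []; _∷_)
import Data.List.Relation.Unary.Unique.Setoid as Unique
open import Data.Nat.Base as ℕ using (ℕ; _^_; _≤_; _≥_)
open import Data.Nat.Primality using (Prime)
open import Data.Product.Base using (Σ; ∃; ∃₂; _×_; _,_; proj₁)
open import Data.Sum.Base using (_⊎_; map; swap)
open import Data.Vec.Functional using (Vector)
import Data.Vec.Functional.Relation.Binary.Equality.Setoid as VecEq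
open import Function.Bundles using (Inverse)
open import Relation.Binary.Bundles using (Setoid)
open import Relation.Binary.Core using (Rel)
open import Relation.Binary.Definitions using (Symmetric; _Respects₂_)
open import Relation.Binary.PropositionalEquality using (_≡_)
import Relation.Binary.PropositionalEquality.Properties as ≡
open import Relation.Nullary.Negation using (¬_)
open import Relation.Unary using (Pred; _⊆_; _⊂_)

private
  variable
    v e a : Level

------------------------------------------------------------------------
-- Simple graphs

-- The vertices form a setoid, so "distinct" means "not _≈_".
record SimpleGraph v e a : Set (suc (v ⊔ e ⊔ a)) where
  field
    vertices : Setoid v e
  open Setoid vertices public renaming (Carrier to Vertex)
  field
    Adjacent : Rel Vertex a
    resp     : Adjacent Respects₂ _≈_
    symm     : Symmetric Adjacent
    loopless : ∀ {x y} → Adjacent x y → ¬ (x ≈ y)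

module _ (G : SimpleGraph v e a) where
  open SimpleGraph G

  data Walk : ℕ → Rel Vertex (v ⊔ e ⊔ a) where
    stop : ∀ {x y} → x ≈ y → Walk 0 x y
    step : ∀ {k x y z} → Adjacent x y → Walk k y z → Walk (ℕ.suc k) x z

  trail : ∀ {k x y} → Walk k x y → List Vertex
  trail {x = x} (stop _)   = x ∷ []
  trail {x = x} (step _ w) = x ∷ trail w

  Path : ℕ → Rel Vertex (v ⊔ e ⊔ a)
  Path k x y = Σ (Walk k x y) λ w → Unique.Unique vertices (trail w)

  Connected : Set (v ⊔ e ⊔ a)
  Connected = ∀ x y → ∃ λ k → Path k x y

  HasDistance : Vertex → Vertex → ℕ → Set (v ⊔ e ⊔ a)
  HasDistance x y d = Path d x y × (∀ k → Path k x y → d ≤ k)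

  -- For a numerical invariant given by its graph (HasValue x k: the value at x
  -- is k), its greatest and least value over all vertices.  The value is
  -- required to exist at every vertex, so an undefined (infinite) value is not
  -- silently skipped.
  IsMaximum IsMinimum : ∀ {p} → (Vertex → ℕ → Set p) → ℕ → Set (v ⊔ p)
  IsMaximum HasValue m =
    (∃ λ x → HasValue x m) × (∀ x → ∃ λ k → HasValue x k × k ≤ m)
  IsMinimum HasValue m =
    (∃ λ x → HasValue x m) × (∀ x → ∃ λ k → HasValue x k × k ≥ m)

  HasEccentricity : Vertex → ℕ → Set (v ⊔ e ⊔ a)
  HasEccentricity x = IsMaximum (HasDistance x)

  HasDiameter HasRadius : ℕ → Set (v ⊔ e ⊔ a)
  HasDiameter = IsMaximum HasEccentricity
  HasRadius   = IsMinimum HasEccentricity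

------------------------------------------------------------------------
-- Finite fields

IsPrimePower : ℕ → Set
IsPrimePower q = ∃₂ λ p k → Prime p × q ≡ p ^ ℕ.suc k

record FiniteField (q : ℕ) c ℓ : Set (suc (c ⊔ ℓ)) where
  field
    commutativeRing : CommutativeRing c ℓ
  open CommutativeRing commutativeRing public
  field
    1≉0         : ¬ (1# ≈ 0#)
    invertible  : ∀ x → ¬ (x ≈ 0#) → Invertible _≈_ 1# _*_ x
    enumeration : Inverse setoid (≡.setoid (Fin q))

------------------------------------------------------------------------
-- Matrices and the left-ideal relation graph

module _ {q : ℕ} {c ℓ : Level} (F : FiniteField q c ℓ) (n : ℕ) where
  open FiniteField F using (Carrier; _*_; setoid; semiring; *-cong; refl)
  open Sum semiring using (sum; sum-cong-≋)

  Matrix : Set c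
  Matrix = Vector (Vector Carrier n) n

  matrixSetoid : Setoid c ℓ
  matrixSetoid = VecEq.≋-setoid (VecEq.≋-setoid setoid n) n

  open Setoid matrixSetoid using () renaming
    (_≈_ to _≈ᴹ_; refl to reflᴹ; sym to symᴹ; trans to transᴹ)

  _*ᴹ_ : Matrix → Matrix → Matrix
  (A *ᴹ B) i j = sum λ k → A i k * B k j

  ⟨_⟩ : Matrix → Pred Matrix (c ⊔ ℓ)
  ⟨ X ⟩ Y = ∃ λ A → Y ≈ᴹ (A *ᴹ X)

  LeftIdealAdjacent : Rel Matrix (c ⊔ ℓ)
  LeftIdealAdjacent X Y = ¬ (X ≈ᴹ Y) × (⟨ X ⟩ ⊂ ⟨ Y ⟩ ⊎ ⟨ Y ⟩ ⊂ ⟨ X ⟩)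

  private
    ⟨⟩-cong : ∀ {X Y} → X ≈ᴹ Y → ⟨ X ⟩ ⊆ ⟨ Y ⟩
    ⟨⟩-cong X≈Y {Z} (A , Z≈AX) = A , transᴹ {Z} Z≈AX
      λ i j → sum-cong-≋ λ k → *-cong refl (X≈Y k j)

    ⊂-cong : ∀ {X X′ Y Y′} → X ≈ᴹ X′ → Y ≈ᴹ Y′ → ⟨ X ⟩ ⊂ ⟨ Y ⟩ → ⟨ X′ ⟩ ⊂ ⟨ Y′ ⟩
    ⊂-cong {X} {X′} {Y} {Y′} p r (X⊆Y , Y⊈X) =
      (λ Z∈ → ⟨⟩-cong {Y} r (X⊆Y (⟨⟩-cong {X′} (symᴹ {X} p) Z∈))) ,
      (λ Y′⊆X′ → Y⊈X λ Z∈ → ⟨⟩-cong {X′} (symᴹ {X} p) (Y′⊆X′ (⟨⟩-cong {Y} r Z∈)))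

    adjacent-cong : ∀ {X X′ Y Y′} → X ≈ᴹ X′ → Y ≈ᴹ Y′ →
                    LeftIdealAdjacent X Y → LeftIdealAdjacent X′ Y′
    adjacent-cong {X} {X′} {Y} {Y′} p r (X≉Y , related) =
      (λ X′≈Y′ → X≉Y (transᴹ {X} p (transᴹ {X′} X′≈Y′ (symᴹ {Y} r)))) ,
      map (⊂-cong {X} {X′} {Y} {Y′} p r) (⊂-cong {Y} {Y′} {X} {X′} r p) related

  leftIdealGraph : SimpleGraph c ℓ (c ⊔ ℓ)
  leftIdealGraph = record
    { vertices = matrixSetoid
    ; Adjacent = LeftIdealAdjacent
    ; resp     = (λ {X} {Y} {Y′} r → adjacent-cong {X} {X} {Y} {Y′} (reflᴹ {X}) r)
               , (λ {Y} {X} {X′} p → adjacent-cong {X} {X′} {Y} {Y} p (reflᴹ {Y}))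
    ; symm     = λ {X} {Y} (X≉Y , related) →
                   (λ Y≈X → X≉Y (symᴹ {Y} Y≈X)) , swap related
    ; loopless = proj₁
    }

{-# OPTIONS --safe #-}

-- The zero matrix generates a left ideal properly contained in that of every
-- nonzero matrix, so it is adjacent to all other vertices: any two vertices are
-- at distance at most 2, and the zero matrix has eccentricity 1.  Distance 2 is
-- attained by two distinct matrices generating the same left ideal, namely a
-- matrix unit and either another unit in the same column or, when n ≡ 1, a
-- multiple of it by a scalar different from 0 and 1.  Finiteness of the field
-- makes adjacency decidable, which is what computes each single eccentricity.
module Submission where

open import Defs
open import Data.Bool.Base using (true; false; if_then_else_; _∧_)
open import Data.Fin.Base using (Fin; zero; suc; finToFun; funToFin)
open import Data.Fin.Properties as Fin
  using (any?; finToFun-funToFin; cantor-schröder-bernstein)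
import Data.List.Relation.Unary.All as All
import Data.List.Relation.Unary.AllPairs as AllPairs
open import Data.Nat.Base using (ℕ; NonZero; zero; suc; z≤n; s≤s; _≤_; _^_)
open import Data.Nat.Properties using (≤-refl)
open import Data.Product.Base using (∃; _×_; _,_; proj₁; proj₂)
open import Data.Sum.Base using (_⊎_; inj₁; inj₂; [_,_]′)
import Data.Vec.Functional.Relation.Binary.Equality.Setoid as VecEq
open import Data.Vec.Functional.Relation.Binary.Pointwise.Properties using (decidable)
open import Function.Base using (_∘_)
open import Function.Bundles using (Inverse; Surjection)
open import Function.Construct.Symmetry using (inverse)
open import Function.Definitions using (Injective)
open import Function.Properties.Inverse using (Inverse⇒Injection; Inverse⇒Surjection)
open import Level using (Level; _⊔_)
open import Relation.Binary.Bundles using (Setoid)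
open import Relation.Binary.Definitions using (Decidable; _Respects_)
open import Relation.Binary.PropositionalEquality as ≡ using (_≡_; _≢_)
open import Relation.Nullary.Decidable
  using (Dec; yes; no; does; map′; ¬?; _×-dec_; _⊎-dec_; decidable-stable;
         via-injection; dec-true; dec-false)
open import Relation.Nullary.Negation using (¬_; contradiction)
open import Relation.Unary as U using (Pred; _⊆_; _⊂_)
import Algebra.Properties.CommutativeMonoid.Sum as CommutativeMonoidSum
import Algebra.Properties.Semiring.Sum as SemiringSum
import Relation.Binary.Reasoning.Setoid as ≈-Reasoning

private
  variable
    a c e ℓ p v : Level

-- Exhaustive search in finite setoids

Enumeration : ℕ → Setoid a ℓ → Set (a ⊔ ℓ)
Enumeration m S = Surjection (≡.setoid (Fin m)) S

-- Repetitions in the enumeration do no harm, so surjectivity is enough. An element is hit only up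
-- to `_≈_`, hence `P` must carry over to its representative.
search : ∀ {m} {S : Setoid a ℓ} → Enumeration m S →
         {P : Pred (Setoid.Carrier S) p} → P Respects Setoid._≈_ S → U.Decidable P → Dec (∃ P)
search {S = S} enum P-resp P? =
  map′ (λ (i , Pi) → to i , Pi)
       (λ (x , Px) → proj₁ (surjective x) ,
                     P-resp (Setoid.sym S (proj₂ (surjective x) ≡.refl)) Px)
       (any? (P? ∘ to))
  where open Surjection enum

-- A number below `m ^ n` is read through its `n` digits in base `m`, each of which `to` decodes
-- into an entry.
vector-enumeration : ∀ {m} {S : Setoid a ℓ} → Enumeration m S →
                     ∀ n → Enumeration (m ^ n) (VecEq.≋-setoid S n)
vector-enumeration {S = S} enum n = record
  { to         = λ k → to ∘ finToFun k
  ; cong       = λ { ≡.refl i → Setoid.refl S }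
  ; surjective = λ xs →
      let code = λ i → proj₁ (surjective (xs i)) in
      funToFin code , λ { ≡.refl i → proj₂ (surjective (xs i)) (finToFun-funToFin code i) }
  }
  where open Surjection enum using (to; surjective)

-- Graphs with a dominating vertex

module _ (G : SimpleGraph v e a) where
  open SimpleGraph G

  module DominatingVertex
    {m : ℕ} (enum : Enumeration m vertices)
    (_≈?_ : Decidable _≈_) (adjacent? : Decidable Adjacent)
    (u w : Vertex) (w≉u : ¬ w ≈ u)
    (dominates : ∀ x → ¬ x ≈ u → Adjacent x u)
    where

    distance-0 : ∀ {x y} → x ≈ y → HasDistance G x y 0
    distance-0 x≈y = (stop x≈y , All.[] AllPairs.∷ AllPairs.[]) , λ _ _ → z≤n

    distance-1 : ∀ {x y} → Adjacent x y → HasDistance G x y 1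
    distance-1 {x} {y} x~y = (step x~y (stop refl) , unique) , minimal
      where
      unique = (loopless x~y All.∷ All.[]) AllPairs.∷ All.[] AllPairs.∷ AllPairs.[]
      minimal : ∀ k → Path G k x y → 1 ≤ k
      minimal _ (stop x≈y , _) = contradiction x≈y (loopless x~y)
      minimal _ (step _ _ , _) = s≤s z≤n

    -- The path goes through `u`. Neither endpoint is `u`, since domination would then make `x` and
    -- `y` adjacent.
    distance-2 : ∀ {x y} → ¬ x ≈ y → ¬ Adjacent x y → HasDistance G x y 2
    distance-2 {x} {y} x≉y x≁y = (step x~u (step u~y (stop refl)) , unique) , minimal
      where
      x≉u : ¬ x ≈ u
      x≉u x≈u = x≁y (proj₂ resp (sym x≈u)
        (symm (dominates y λ y≈u → x≉y (trans x≈u (sym y≈u)))))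
      x~u = dominates x x≉u
      u~y = symm (dominates y λ y≈u → x≁y (proj₁ resp (sym y≈u) x~u))
      unique = (x≉u All.∷ x≉y All.∷ All.[]) AllPairs.∷
               (loopless u~y All.∷ All.[]) AllPairs.∷ All.[] AllPairs.∷ AllPairs.[]
      minimal : ∀ k → Path G k x y → 2 ≤ k
      minimal _ (stop x≈y , _)                = contradiction x≈y x≉y
      minimal _ (step x~z (stop z≈y) , _)     = contradiction (proj₁ resp z≈y x~z) x≁y
      minimal _ (step _ (step _ _) , _)       = s≤s (s≤s z≤n)

    distance≤2 : ∀ x y → ∃ λ k → HasDistance G x y k × k ≤ 2
    distance≤2 x y with x ≈? y | adjacent? x y
    ... | yes x≈y | _       = 0 , distance-0 x≈y , z≤n
    ... | no  _   | yes x~y = 1 , distance-1 x~y , s≤s z≤n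
    ... | no  x≉y | no x≁y  = 2 , distance-2 x≉y x≁y , ≤-refl

    connected : Connected G
    connected x y = let k , (path , _) , _ = distance≤2 x y in k , path

    eccentricity-2 : ∀ {x y} → ¬ x ≈ y → ¬ Adjacent x y → HasEccentricity G x 2
    eccentricity-2 {x} {y} x≉y x≁y = (y , distance-2 x≉y x≁y) , distance≤2 x

    -- Eccentricity 1 must be attained, so each vertex needs a vertex other than itself: `u` serves
    -- all but `u`, for which `w` is kept.
    another : ∀ x → ∃ λ y → ¬ x ≈ y
    another x with x ≈? u
    ... | yes x≈u = w , λ x≈w → w≉u (trans (sym x≈w) x≈u)
    ... | no  x≉u = u , x≉u

    eccentricity-1 : ∀ {x} → (∀ y → ¬ x ≈ y → Adjacent x y) → HasEccentricity G x 1
    eccentricity-1 {x} dom = (y , distance-1 (dom y x≉y)) , distance≤1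
      where
      y = proj₁ (another x)
      x≉y = proj₂ (another x)
      distance≤1 : ∀ z → ∃ λ k → HasDistance G x z k × k ≤ 1
      distance≤1 z with x ≈? z
      ... | yes x≈z = 0 , distance-0 x≈z , z≤n
      ... | no  x≉z = 1 , distance-1 (dom z x≉z) , ≤-refl

    -- The search for a vertex neither equal nor adjacent to `x` decides the value: a hit is at
    -- distance 2, and failure means that `x` is dominating too.
    eccentricity : ∀ x → HasEccentricity G x 1 ⊎ HasEccentricity G x 2
    eccentricity x with search enum
      (λ y≈z (x≉y , x≁y) → (λ x≈z → x≉y (trans x≈z (sym y≈z))) ,
                           (λ x~z → x≁y (proj₁ resp (sym y≈z) x~z)))
      (λ y → ¬? (x ≈? y) ×-dec ¬? (adjacent? x y))
    ... | yes (_ , x≉y , x≁y) = inj₂ (eccentricity-2 x≉y x≁y)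
    ... | no  none            = inj₁ (eccentricity-1 λ y x≉y →
      decidable-stable (adjacent? x y) λ x≁y → none (y , x≉y , x≁y))

    radius-1 : HasRadius G 1
    radius-1 = (u , eccentricity-1 λ y u≉y → symm (dominates y (u≉y ∘ sym))) , λ x →
      [ (λ ecc → 1 , ecc , ≤-refl) , (λ ecc → 2 , ecc , s≤s z≤n) ]′ (eccentricity x)

    diameter-2 : ∀ {x y} → ¬ x ≈ y → ¬ Adjacent x y → HasDiameter G 2
    diameter-2 {x} x≉y x≁y = (x , eccentricity-2 x≉y x≁y) , λ z →
      [ (λ ecc → 1 , ecc , s≤s z≤n) , (λ ecc → 2 , ecc , ≤-refl) ]′ (eccentricity z)

-- Finite fields

module FiniteFieldProperties {q : ℕ} (F : FiniteField q c ℓ) where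
  open FiniteField F hiding (zero)

  elements : Enumeration q setoid
  elements = Inverse⇒Surjection (inverse enumeration)

  _≈?_ : Decidable _≈_
  _≈?_ = via-injection (Inverse⇒Injection enumeration) Fin._≟_

  -- If 0 and 1 were the only elements, testing for 0 would inject `Fin q` into `Fin 2`, while 0 and
  -- 1 inject `Fin 2` into `Fin q`; together these force `q ≡ 2`.
  third-element : q ≢ 2 → ∃ λ x → ¬ x ≈ 0# × ¬ x ≈ 1#
  third-element q≢2 with search elements
    (λ x≈y (x≉0 , x≉1) → x≉0 ∘ trans x≈y , x≉1 ∘ trans x≈y)
    (λ x → ¬? (x ≈? 0#) ×-dec ¬? (x ≈? 1#))
  ... | yes found = found
  ... | no  none  = contradiction (cantor-schröder-bernstein {f = to-bit} {g = of-bit}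
                                     to-bit-injective of-bit-injective) q≢2
    where
    open Inverse enumeration using (to; from; to-cong; strictlyInverseˡ; strictlyInverseʳ)

    ≉0⇒≈1 : ∀ {x} → ¬ x ≈ 0# → x ≈ 1#
    ≉0⇒≈1 {x} x≉0 = decidable-stable (x ≈? 1#) λ x≉1 → none (x , x≉0 , x≉1)

    from-injective : ∀ {i j} → from i ≈ from j → i ≡ j
    from-injective {i} {j} eq =
      ≡.trans (≡.sym (strictlyInverseˡ i)) (≡.trans (to-cong eq) (strictlyInverseˡ j))

    -- With the decision as an argument, injectivity is a plain case split on two decisions.
    bit : ∀ {x} → Dec (x ≈ 0#) → Fin 2
    bit x≟0 = if does x≟0 then zero else suc zero

    bit-injective : ∀ {x y} (x≟0 : Dec (x ≈ 0#)) (y≟0 : Dec (y ≈ 0#)) →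
                    bit x≟0 ≡ bit y≟0 → x ≈ y
    bit-injective (yes x≈0) (yes y≈0) _ = trans x≈0 (sym y≈0)
    bit-injective (no  x≉0) (no  y≉0) _ = trans (≉0⇒≈1 x≉0) (sym (≉0⇒≈1 y≉0))

    to-bit : Fin q → Fin 2
    to-bit i = bit (from i ≈? 0#)

    to-bit-injective : Injective _≡_ _≡_ to-bit
    to-bit-injective {i} {j} eq =
      from-injective (bit-injective (from i ≈? 0#) (from j ≈? 0#) eq)

    of-bit : Fin 2 → Fin q
    of-bit zero    = to 0#
    of-bit (suc _) = to 1#

    to-0≢to-1 : to 0# ≢ to 1#
    to-0≢to-1 eq = 1≉0 (trans (sym (strictlyInverseʳ 1#))
      (trans (Inverse.from-cong enumeration (≡.sym eq)) (strictlyInverseʳ 0#)))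

    of-bit-injective : Injective _≡_ _≡_ of-bit
    of-bit-injective {zero}     {zero}     _  = ≡.refl
    of-bit-injective {suc zero} {suc zero} _  = ≡.refl
    of-bit-injective {zero}     {suc _}    eq = contradiction eq to-0≢to-1
    of-bit-injective {suc _}    {zero}     eq = contradiction (≡.sym eq) to-0≢to-1

-- Matrix algebra and left ideals

module LeftIdeals {q : ℕ} (F : FiniteField q c ℓ) (n : ℕ) where
  open FiniteField F hiding (zero)
  open FiniteFieldProperties F
  open CommutativeMonoidSum +-commutativeMonoid using (∑-comm)
  open SemiringSum semiring
    using (sum; sum-cong-≋; sum-replicate-zero; *-distribˡ-sum; *-distribʳ-sum)
  open Setoid (matrixSetoid F n) using () renaming
    (_≈_ to _≈ᴹ_; refl to reflᴹ; sym to symᴹ; trans to transᴹ)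

  private
    Mat : Set _
    Mat = Matrix F n

    infixl 7 _·_
    _·_ : Mat → Mat → Mat
    _·_ = _*ᴹ_ F n

    ideal : Mat → Pred Mat _
    ideal = ⟨_⟩ F n

  sum-zero : ∀ {k} {f : Fin k → Carrier} → (∀ i → f i ≈ 0#) → sum f ≈ 0#
  sum-zero {k} f≈0 = trans (sum-cong-≋ f≈0) (sum-replicate-zero k)

  -- Evaluates the entries of products with `1ᴹ` or with matrix units, where one index alone
  -- contributes.
  sum-single : ∀ {k} (f : Fin k → Carrier) j → (∀ i → i ≢ j → f i ≈ 0#) → sum f ≈ f j
  sum-single f zero    f≈0 =
    trans (+-congˡ (sum-zero λ i → f≈0 (suc i) λ ())) (+-identityʳ _)
  sum-single f (suc j) f≈0 = trans
    (+-cong (f≈0 zero λ ())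
            (sum-single (f ∘ suc) j λ i i≢j → f≈0 (suc i) (i≢j ∘ Fin.suc-injective)))
    (+-identityˡ _)

  ·-congˡ : ∀ {A B C} → B ≈ᴹ C → A · B ≈ᴹ A · C
  ·-congˡ B≈C i j = sum-cong-≋ λ k → *-congˡ (B≈C k j)

  ·-congʳ : ∀ {A B C} → A ≈ᴹ B → A · C ≈ᴹ B · C
  ·-congʳ A≈B i j = sum-cong-≋ λ k → *-congʳ (A≈B i k)

  -- Both sides expand to the same double sum; the essential step is exchanging the order of
  -- summation.
  ·-assoc : ∀ A B C → (A · B) · C ≈ᴹ A · (B · C)
  ·-assoc A B C i j = begin
    sum (λ k → sum (λ l → A i l * B l k) * C k j)
      ≈⟨ sum-cong-≋ (λ k → *-distribʳ-sum (C k j) (λ l → A i l * B l k)) ⟩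
    sum (λ k → sum (λ l → (A i l * B l k) * C k j))
      ≈⟨ ∑-comm (λ k l → (A i l * B l k) * C k j) ⟩
    sum (λ l → sum (λ k → (A i l * B l k) * C k j))
      ≈⟨ sum-cong-≋ (λ l → sum-cong-≋ (λ k → *-assoc (A i l) (B l k) (C k j))) ⟩
    sum (λ l → sum (λ k → A i l * (B l k * C k j)))
      ≈⟨ sum-cong-≋ (λ l → sym (*-distribˡ-sum (A i l) (λ k → B l k * C k j))) ⟩
    sum (λ l → A i l * sum (λ k → B l k * C k j)) ∎
    where open ≈-Reasoning setoid

  0ᴹ 1ᴹ : Mat
  0ᴹ _ _ = 0#
  1ᴹ i j = if does (i Fin.≟ j) then 1# else 0#

  ·-identityˡ : ∀ X → 1ᴹ · X ≈ᴹ X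
  ·-identityˡ X i j = trans (sum-single (λ k → 1ᴹ i k * X k j) i off-diagonal) diagonal
    where
    off-diagonal : ∀ k → k ≢ i → 1ᴹ i k * X k j ≈ 0#
    off-diagonal k k≢i rewrite dec-false (i Fin.≟ k) (k≢i ∘ ≡.sym) = zeroˡ _
    diagonal : 1ᴹ i i * X i j ≈ X i j
    diagonal rewrite dec-true (i Fin.≟ i) ≡.refl = *-identityˡ _

  ·-zeroˡ : ∀ X → 0ᴹ · X ≈ᴹ 0ᴹ
  ·-zeroˡ X i j = sum-zero λ k → zeroˡ (X k j)

  ·-zeroʳ : ∀ A → A · 0ᴹ ≈ᴹ 0ᴹ
  ·-zeroʳ A i j = sum-zero λ k → zeroʳ (A i k)

  ∈ideal-self : ∀ X → ideal X X
  ∈ideal-self X = 1ᴹ , symᴹ {1ᴹ · X} (·-identityˡ X)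

  -- By associativity `B X = B (A Y) = (B A) Y`, so an inclusion of ideals need only be checked on
  -- the generator.
  ideal-⊆ : ∀ {X Y} → ideal Y X → ideal X ⊆ ideal Y
  ideal-⊆ {X} {Y} (A , X≈AY) {Z} (B , Z≈BX) = B · A ,
    transᴹ {Z} Z≈BX (transᴹ {B · X} (·-congˡ {B} {X} X≈AY)
      (symᴹ {(B · A) · Y} (·-assoc B A Y)))

  -- Decidability of adjacency

  matrices : Enumeration ((q ^ n) ^ n) (matrixSetoid F n)
  matrices = vector-enumeration (vector-enumeration elements n) n

  _≈ᴹ?_ : Decidable _≈ᴹ_
  _≈ᴹ?_ = decidable (decidable _≈?_)

  ∈ideal? : ∀ X → U.Decidable (ideal X)
  ∈ideal? X Y = search matrices
    (λ {A} {B} A≈B Y≈AX → transᴹ {Y} Y≈AX (·-congʳ {A} {B} {X} A≈B))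
    (λ A → Y ≈ᴹ? (A · X))

  -- Inclusion quantifies over all members of an ideal, but is equivalent to membership of the
  -- generator, which a single search over multipliers settles.
  ideal-⊆? : ∀ X Y → Dec (ideal X ⊆ ideal Y)
  ideal-⊆? X Y = map′ (ideal-⊆ {X} {Y}) (λ X⊆Y → X⊆Y (∈ideal-self X)) (∈ideal? Y X)

  ideal-⊂? : ∀ X Y → Dec (ideal X ⊂ ideal Y)
  ideal-⊂? X Y = ideal-⊆? X Y ×-dec ¬? (ideal-⊆? Y X)

  adjacent? : Decidable (LeftIdealAdjacent F n)
  adjacent? X Y = ¬? (X ≈ᴹ? Y) ×-dec (ideal-⊂? X Y ⊎-dec ideal-⊂? Y X)

  -- The zero matrix and matrix units

  -- Zero lies in every left ideal, whereas its own ideal contains only zero and so misses `X`.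
  adjacent-0ᴹ : ∀ X → ¬ X ≈ᴹ 0ᴹ → LeftIdealAdjacent F n X 0ᴹ
  adjacent-0ᴹ X X≉0 = X≉0 , inj₂
    ( ideal-⊆ {0ᴹ} {X} (0ᴹ , symᴹ {0ᴹ · X} (·-zeroˡ X))
    , λ X⊆0 → let A , X≈A0 = X⊆0 (∈ideal-self X) in
              X≉0 (transᴹ {X} X≈A0 (·-zeroʳ A)))

  -- The generators lie in each other's ideals, so the ideals coincide and neither inclusion is
  -- proper.
  same-ideal⇒≁ : ∀ {X Y} → ideal Y X → ideal X Y → ¬ LeftIdealAdjacent F n X Y
  same-ideal⇒≁ {X} {Y} X∈Y Y∈X (_ , inj₁ (_ , Y⊈X)) = Y⊈X (ideal-⊆ {Y} {X} Y∈X)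
  same-ideal⇒≁ {X} {Y} X∈Y Y∈X (_ , inj₂ (_ , X⊈Y)) = X⊈Y (ideal-⊆ {X} {Y} X∈Y)

  -- The scaled matrix unit `x E_ij`; the scalar provides distinct generators of one ideal even for
  -- 1 × 1 matrices.
  unit : Fin n → Fin n → Carrier → Mat
  unit i j x k l = if does (i Fin.≟ k) ∧ does (j Fin.≟ l) then x else 0#

  unit-· : ∀ i j l x y → unit i j x · unit j l y ≈ᴹ unit i l (x * y)
  unit-· i j l x y r s = trans (sum-single _ j off-diagonal) diagonal
    where
    off-diagonal : ∀ k → k ≢ j → unit i j x r k * unit j l y k s ≈ 0#
    -- The row test of the right factor fails, so that factor vanishes whatever the left one is.
    off-diagonal k k≢j rewrite dec-false (j Fin.≟ k) (k≢j ∘ ≡.sym) = zeroʳ _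
    diagonal : unit i j x r j * unit j l y j s ≈ unit i l (x * y) r s
    -- Both tests against `j` succeed, leaving only those of `i` against `r` and of `l` against `s`.
    diagonal rewrite dec-true (j Fin.≟ j) ≡.refl with does (i Fin.≟ r) | does (l Fin.≟ s)
    ... | true  | true  = refl
    ... | true  | false = zeroʳ x
    ... | false | _     = zeroˡ _

  unit-cong : ∀ i j {x y} → x ≈ y → unit i j x ≈ᴹ unit i j y
  unit-cong i j x≈y k l with does (i Fin.≟ k) ∧ does (j Fin.≟ l)
  ... | true  = x≈y
  ... | false = refl

  -- Left multiplication by `x y⁻¹ E_ij` moves row `j` to row `i` and rescales it, keeping the
  -- column `l`. Hence nonzero multiples of units in one column generate the same ideal.
  unit-∈ideal : ∀ i j l {x y} → ¬ y ≈ 0# → ideal (unit j l y) (unit i l x)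
  unit-∈ideal i j l {x} {y} y≉0 = unit i j (x * y⁻¹) ,
    transᴹ {unit i l x} (unit-cong i l (sym x*y⁻¹*y≈x))
      (symᴹ {unit i j (x * y⁻¹) · unit j l y} (unit-· i j l (x * y⁻¹) y))
    where
    y⁻¹ = proj₁ (invertible y y≉0)
    x*y⁻¹*y≈x : (x * y⁻¹) * y ≈ x
    x*y⁻¹*y≈x = trans (*-assoc x y⁻¹ y)
      (trans (*-congˡ (proj₁ (proj₂ (invertible y y≉0)))) (*-identityʳ x))

  unit-≁ : ∀ i j l {x y} → ¬ x ≈ 0# → ¬ y ≈ 0# →
           ¬ LeftIdealAdjacent F n (unit i l x) (unit j l y)
  unit-≁ i j l {x} {y} x≉0 y≉0 = same-ideal⇒≁ {unit i l x} {unit j l y}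
    (unit-∈ideal i j l y≉0) (unit-∈ideal j i l x≉0)

-- A pair at distance 2

module _ {q : ℕ} (F : FiniteField q c ℓ) where
  open FiniteField F hiding (zero)
  open FiniteFieldProperties F
  open LeftIdeals F

  -- In the excluded case the only matrices are 0 and 1, which are adjacent, so there is no such
  -- pair.
  distinct-nonadjacent : ∀ m → ¬ (suc m ≡ 1 × q ≡ 2) →
    ∃ λ X → ∃ λ Y → ¬ Setoid._≈_ (matrixSetoid F (suc m)) X Y ×
                    ¬ LeftIdealAdjacent F (suc m) X Y
  -- With a single matrix position the two generators can differ only by a scalar, which calls for a
  -- nonzero element other than 1.
  distinct-nonadjacent zero ¬n≡1×q≡2 =
    let x , x≉0 , x≉1 = third-element (λ q≡2 → ¬n≡1×q≡2 (≡.refl , q≡2)) in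
    unit 1 zero zero x , unit 1 zero zero 1# ,
    (λ X≈Y → x≉1 (X≈Y zero zero)) ,
    unit-≁ 1 zero zero zero x≉0 1≉0
  -- With two rows at hand, the entry 1 is put in the first column at two different heights, over
  -- any field.
  distinct-nonadjacent (suc m) _ =
    unit n zero zero 1# , unit n (suc zero) zero 1# ,
    (λ X≈Y → 1≉0 (X≈Y zero zero)) ,
    unit-≁ n zero (suc zero) zero 1≉0 1≉0
    where n = suc (suc m)

corollary4p4 : ∀ {c ℓ} (q n : ℕ) → IsPrimePower q → .{{_ : NonZero n}} →
    (F : FiniteField q c ℓ) →
    Connected (leftIdealGraph F n)
    × (¬ (n ≡ 1 × q ≡ 2) → HasDiameter (leftIdealGraph F n) 2)
    × HasRadius (leftIdealGraph F n) 1
corollary4p4 q (suc m) _ F =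
  connected ,
  (λ ¬n≡1×q≡2 → let X , Y , X≉Y , X≁Y = distinct-nonadjacent F m ¬n≡1×q≡2 in
                diameter-2 {X} {Y} X≉Y X≁Y) ,
  radius-1
  where
  open FiniteField F using (1#; 1≉0)
  open LeftIdeals F (suc m)
  -- `0ᴹ` is the dominating vertex; the corner unit, available because the size is `suc m`, is the
  -- second vertex that rules out eccentricity 0.
  open DominatingVertex (leftIdealGraph F (suc m)) matrices _≈ᴹ?_ adjacent?
    0ᴹ (unit zero zero 1#) (λ E≈0 → 1≉0 (E≈0 zero zero)) adjacent-0ᴹ
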